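{- For every positive integer $n$, the number of ordered set partitions of $[n]$ into exactly $3$ blocks that avoid the pattern $123$ is $$\operatorname{op}_{n,3}(123) = \left(\frac{n^2}{8}+\frac{3n}{8}-2\right)2^n+3.$$
   Context: An ordered set partition of $[n]$ into $k$ blocks is a sequence $B_1/B_2/\cdots/B_k$ of nonempty, pairwise disjoint subsets of $[n]$ whose union is $[n]$; the order of the blocks matters, but not the order of elements within a block. For a permutation $\rho=\rho_1\cdots\rho_m\in\mathcal{S}_m$, an ordered partition $B_1/\cdots/B_k$ contains $\rho$ if there are block indices $i_1<i_2<\cdots<i_m$ and elements $b_j\in B_{i_j}$ such that $b_1\cdots b_m$ is order-isomorphic to $\rho$ (i.e. $b_a<b_c$ iff $\rho_a<\rho_c$); otherwise it avoids $\rho$. $\operatorname{op}_{n,k}(\rho)$ denotes the number of ordered partitions of $[n]$ into $k$ blocks that avoid $\rho$. -}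

module Defs where

open import Data.Bool.Properties using () renaming (_≟_ to _≟ᵇ_)
open import Data.Fin using (Fin; _<_)
open import Data.Fin.Permutation using (Permutation′; _⟨$⟩ʳ_; id)
open import Data.Fin.Properties using (_≟_; _<?_; all?; any?)
open import Data.Fin.Subset using (Subset; inside; outside; _∈_; _∩_; ⋃; ⊤; Nonempty; Empty)
open import Data.Fin.Subset.Properties using (_∈?_; nonempty?)
open import Data.List using (List; []; _∷_; length; filter; cartesianProductWith)
import Data.List.Membership.Propositional as List
open import Data.List.Membership.Propositional.Properties using (∈-cartesianProductWith⁺)
import Data.List.Relation.Unary.All as All
open import Data.List.Relation.Unary.AllPairs using ([]; _∷_)
open import Data.List.Relation.Unary.Any using (here; there)
open import Data.List.Relation.Unary.Unique.Propositional using (Unique)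
open import Data.List.Relation.Unary.Unique.Propositional.Properties using (cartesianProductWith⁺)
open import Data.Nat using (ℕ; zero; suc)
open import Data.Product using (∃; _×_; _,_; uncurry; <_,_>)
open import Data.Vec using (Vec; []; _∷_; lookup; toList)
open import Data.Vec.Properties using (≡-dec; ∷-injective)
open import Function using (_∘_)
open import Function.Bundles using (_⇔_; mk⇔; Equivalence)
open import Level using (Level)
open import Relation.Binary.PropositionalEquality using (_≡_; _≢_; refl)
open import Relation.Nullary using (¬_; Dec; ¬?; _×-dec_; _→-dec_)
open import Relation.Nullary.Decidable using (map′)
open import Relation.Unary using (Pred; Decidable)

private
  variable
    a ℓ : Level
    A : Set a
    m n k : ℕ

-- The set [n] is represented by Fin n (shifting 1, …, n to 0, …, n - 1), and
-- a sequence of k subsets B₁ / ⋯ / Bₖ of [n] by a vector in Vec (Subset n) k.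

record IsOrderedPartition {n k : ℕ} (B : Vec (Subset n) k) : Set where
  constructor isOrderedPartition
  field
    nonempty : ∀ i → Nonempty (lookup B i)
    disjoint : ∀ i j → i ≢ j → Empty (lookup B i ∩ lookup B j)
    union    : ⋃ (toList B) ≡ ⊤

Increasing : Vec (Fin k) m → Set
Increasing is = ∀ a c → a < c → lookup is a < lookup is c

-- A permutation ρ of Fin m is read in one-line notation: its a-th letter is
-- ρ ⟨$⟩ʳ a.
OrderIsomorphic : Vec (Fin n) m → Permutation′ m → Set
OrderIsomorphic b ρ = ∀ a c → (lookup b a < lookup b c) ⇔ (ρ ⟨$⟩ʳ a < ρ ⟨$⟩ʳ c)

Occurrence : Vec (Subset n) k → Permutation′ m → Vec (Fin k) m → Vec (Fin n) m → Set
Occurrence B ρ is b =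
  Increasing is
  × (∀ j → lookup b j ∈ lookup B (lookup is j))
  × OrderIsomorphic b ρ

Contains : Vec (Subset n) k → Permutation′ m → Set
Contains B ρ = ∃ λ is → ∃ λ b → Occurrence B ρ is b

Avoids : Vec (Subset n) k → Permutation′ m → Set
Avoids B ρ = ¬ Contains B ρ

isOrderedPartition? : (B : Vec (Subset n) k) → Dec (IsOrderedPartition B)
isOrderedPartition? B =
  map′ (λ (p , q , r) → isOrderedPartition p q r)
       (λ (isOrderedPartition p q r) → p , q , r)
       (all? (λ i → nonempty? (lookup B i))
        ×-dec all? (λ i → all? λ j →
                ¬? (i ≟ j) →-dec ¬? (nonempty? (lookup B i ∩ lookup B j)))
        ×-dec ≡-dec _≟ᵇ_ (⋃ (toList B)) ⊤)

anyVec? : {P : Pred (Vec (Fin n) m) ℓ} → Decidable P → Dec (∃ P)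
anyVec? {m = zero} P? =
  map′ (λ p → [] , p) (λ { ([] , p) → p }) (P? [])
anyVec? {m = suc m} P? =
  map′ (λ (x , xs , p) → x ∷ xs , p)
       (λ { (x ∷ xs , p) → x , xs , p })
       (any? λ x → anyVec? (P? ∘ (x ∷_)))

_⇔-dec_ : {P Q : Set} → Dec P → Dec Q → Dec (P ⇔ Q)
P? ⇔-dec Q? =
  map′ (uncurry mk⇔) < Equivalence.to , Equivalence.from >
       ((P? →-dec Q?) ×-dec (Q? →-dec P?))

occurrence? : (B : Vec (Subset n) k) (ρ : Permutation′ m) →
              ∀ is b → Dec (Occurrence B ρ is b)
occurrence? B ρ is b =
  all? (λ a → all? λ c → (a <? c) →-dec (lookup is a <? lookup is c))
  ×-dec all? (λ j → lookup b j ∈? lookup B (lookup is j))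
  ×-dec all? (λ a → all? λ c →
          (lookup b a <? lookup b c) ⇔-dec (ρ ⟨$⟩ʳ a <? ρ ⟨$⟩ʳ c))

contains? : (B : Vec (Subset n) k) (ρ : Permutation′ m) → Dec (Contains B ρ)
contains? B ρ = anyVec? λ is → anyVec? λ b → occurrence? B ρ is b

avoids? : (B : Vec (Subset n) k) (ρ : Permutation′ m) → Dec (Avoids B ρ)
avoids? B ρ = ¬? (contains? B ρ)

vectors : List A → ∀ k → List (Vec A k)
vectors xs zero    = [] ∷ []
vectors xs (suc k) = cartesianProductWith _∷_ xs (vectors xs k)

subsets : ∀ n → List (Subset n)
subsets = vectors (inside ∷ outside ∷ [])

op : (n k : ℕ) → Permutation′ m → ℕ
op n k ρ =
  length (filter (λ B → isOrderedPartition? B ×-dec avoids? B ρ)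
                 (vectors (subsets n) k))

pattern123 : Permutation′ 3
pattern123 = id

-- The list filtered in op contains each sequence of k subsets of [n] exactly
-- once, so op really is a cardinality.

vectors-complete : {xs : List A} → (∀ x → x List.∈ xs) →
                   (v : Vec A k) → v List.∈ vectors xs k
vectors-complete all []      = here refl
vectors-complete all (x ∷ v) =
  ∈-cartesianProductWith⁺ _∷_ (all x) (vectors-complete all v)

vectors-unique : {xs : List A} → Unique xs → ∀ k → Unique (vectors xs k)
vectors-unique u zero    = All.[] ∷ []
vectors-unique u (suc k) =
  cartesianProductWith⁺ _∷_ ∷-injective u (vectors-unique u k)

candidates-complete : (B : Vec (Subset n) k) → B List.∈ vectors (subsets n) k
candidates-complete =
  vectors-complete (vectors-complete λ { inside → here refl ; outside → there (here refl) })

candidates-unique : ∀ n k → Unique (vectors (subsets n) k)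
candidates-unique n =
  vectors-unique (vectors-unique (((λ ()) All.∷ All.[]) ∷ All.[] ∷ []) n)

{-# OPTIONS --safe #-}
module Submission where

-- Recording for each element the index of its block turns the ordered
-- partitions of [n] into k blocks into the words of length n that use all k
-- letters.  Such a partition contains 12⋯k iff the word has 12⋯k as a
-- subsequence, since the block indices of an occurrence must be 1, 2, …, k.
-- Reading the word letter by letter, only two things matter: which letters
-- are still needed and which suffix of 12⋯k is still to be completed.  For
-- k = 3 the resulting linear recurrences are solved by explicit multiples of
-- 2ⁿ with polynomial coefficients.

open import Defs
open import Data.Bool using (true; false; if_then_else_)
open import Data.Fin as Fin using (Fin; zero; suc; _<_)
open import Data.Fin.Patterns using (0F; 1F; 2F)
open import Data.Fin.Permutation using (id)
open import Data.Fin.Properties using (_≟_; <-cmp; <-irrefl; <-asym)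
open import Data.Fin.Subset using (Subset; _∈_; ⋃)
open import Data.Fin.Subset.Properties using (∈⊤; ∉⊥; ⊆⊤; ⊆-antisym; x∈p∩q⁺; x∈p∩q⁻; x∈p∪q⁺; x∈p∪q⁻)
open import Data.Integer as ℤ using (+_)
import Data.Integer.Properties as ℤ
import Data.Integer.Tactic.RingSolver as ℤ-Solver
open import Data.List as List using (List; []; _∷_; length; filter; cartesianProductWith)
import Data.List.Membership.Propositional as List
open import Data.List.Membership.Propositional.Properties using (∈-allFin; ∈-filter⁺; ∈-filter⁻; ∈-map⁺; ∈-map⁻)
open import Data.List.Membership.Propositional.Properties.WithK using (unique∧set⇒bag)
open import Data.List.Properties using (filter-++; filter-none; filter-≐; length-++; length-map) renaming (map-cong to map-congˡ)
open import Data.List.Relation.Binary.BagAndSetEquality using (∼bag⇒↭)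
open import Data.List.Relation.Binary.Permutation.Propositional.Properties using (↭-length)
open import Data.List.Relation.Binary.Pointwise using (Pointwise-≡⇒≡)
open import Data.List.Relation.Binary.Sublist.Propositional using ([]; _∷_; _∷ʳ_; minimum) renaming (_⊆_ to _≼_)
import Data.List.Relation.Binary.Sublist.DecPropositional as DecSublist
open import Data.List.Relation.Binary.Sublist.Propositional.Properties using (∷⁻; ∷ʳ⁻; to-≋)
open import Data.List.Relation.Unary.All as All using (All; []; _∷_)
open import Data.List.Relation.Unary.Unique.Propositional using (Unique)
open import Data.List.Relation.Unary.Unique.Propositional.Properties as Unique using (allFin⁺)
open import Data.Nat as ℕ using (ℕ; zero; suc; s≤s; z≤n)
import Data.Nat.Properties as ℕ
open import Data.Nat.ListAction using (sum)
open import Data.Nat.Tactic.RingSolver using (solve-∀)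
open import Data.Product using (∃; _×_; _,_; proj₁; proj₂)
open import Data.Rational using (_/_; _+_; _-_; _*_; -_; toℚᵘ)
import Data.Rational.Properties as ℚ
open import Data.Rational.Unnormalised as ℚᵘ using (mkℚᵘ; *≡*; _≃_)
import Data.Rational.Unnormalised.Properties as ℚᵘ
open import Data.Sum using (inj₁; inj₂)
open import Data.Vec as Vec using (Vec; []; _∷_; lookup; map; tabulate; toList)
import Data.Vec.Membership.DecPropositional as DecMembership
open import Data.Vec.Membership.Propositional using () renaming (_∈_ to _∈ᵥ_)
open import Data.Vec.Membership.Propositional.Properties using (∈-lookup)
open import Data.Vec.Properties using ([]=⇒lookup; lookup⇒[]=; lookup-map; lookup∘tabulate; tabulate∘lookup; tabulate-cong; map-id; map-∘; map-cong; lookup-allFin; length-toList; toList-injective; cast-is-id)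
open import Data.Vec.Relation.Unary.Any as Any using (here; there)
open import Data.Vec.Relation.Unary.Any.Properties using (lookup-index)
open import Function using (_∘_; flip)
open import Function.Bundles using (mk⇔; Equivalence)
open import Level using (0ℓ)
open import Relation.Binary.Definitions using (tri<; tri≈; tri>)
open import Relation.Binary.PropositionalEquality using (_≡_; refl; sym; trans; cong; cong₂; subst; subst₂; module ≡-Reasoning)
open import Relation.Nullary using (¬_; yes; no; does; ¬?; _×-dec_; contradiction)
open import Relation.Nullary.Decidable using (dec-true)
open import Relation.Unary using (Pred; Decidable)

private
  variable
    A B : Set
    m n k : ℕ

-- Words as encodings of ordered partitions.

blocks : Vec (Fin k) n → Vec (Subset n) k
blocks w = tabulate λ i → map (λ l → does (i ≟ l)) w

lookup-blocks : ∀ (w : Vec (Fin k) n) i x →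
                lookup (lookup (blocks w) i) x ≡ does (i ≟ lookup w x)
lookup-blocks w i x =
  trans (cong (flip lookup x) (lookup∘tabulate _ i)) (lookup-map x _ w)

∈-blocks⁺ : ∀ (w : Vec (Fin k) n) {i x} → lookup w x ≡ i → x ∈ lookup (blocks w) i
∈-blocks⁺ w {i} {x} eq =
  lookup⇒[]= x _ (trans (lookup-blocks w i x) (dec-true (i ≟ _) (sym eq)))

∈-blocks⁻ : ∀ (w : Vec (Fin k) n) {i x} → x ∈ lookup (blocks w) i → lookup w x ≡ i
∈-blocks⁻ w {i} {x} x∈ with i ≟ lookup w x | trans (sym (lookup-blocks w i x)) ([]=⇒lookup x∈)
... | yes eq | _  = sym eq
... | no _   | ()

lookup-ext : {v w : Vec A n} → (∀ x → lookup v x ≡ lookup w x) → v ≡ w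
lookup-ext {v = v} {w} eq =
  trans (sym (tabulate∘lookup v)) (trans (tabulate-cong eq) (tabulate∘lookup w))

-- Each `x` lies in block `lookup v x` of `blocks v`, hence of `blocks w`, and membership there
-- determines the letter of `w` at `x`.
blocks-injective : {v w : Vec (Fin k) n} → blocks v ≡ blocks w → v ≡ w
blocks-injective {v = v} {w} eq = lookup-ext λ x →
  sym (∈-blocks⁻ w (subst (λ B → x ∈ lookup B (lookup v x)) eq (∈-blocks⁺ v refl)))

∈-⋃⁺ : ∀ (B : Vec (Subset n) k) i {x} → x ∈ lookup B i → x ∈ ⋃ (toList B)
∈-⋃⁺ (p ∷ B) zero    x∈ = x∈p∪q⁺ (inj₁ x∈)
∈-⋃⁺ (p ∷ B) (suc i) x∈ = x∈p∪q⁺ {p = p} (inj₂ (∈-⋃⁺ B i x∈))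

∈-⋃⁻ : ∀ (B : Vec (Subset n) k) {x} → x ∈ ⋃ (toList B) → ∃ λ i → x ∈ lookup B i
∈-⋃⁻ []      x∈ = contradiction x∈ ∉⊥
∈-⋃⁻ (p ∷ B) x∈ with x∈p∪q⁻ p _ x∈
... | inj₁ x∈p = zero , x∈p
... | inj₂ x∈B = let i , x∈Bᵢ = ∈-⋃⁻ B x∈B in suc i , x∈Bᵢ

onto⇒partition : {w : Vec (Fin k) n} → (∀ i → i ∈ᵥ w) → IsOrderedPartition (blocks w)
onto⇒partition {w = w} onto = isOrderedPartition
  (λ i → Any.index (onto i) , ∈-blocks⁺ w (sym (lookup-index (onto i))))
  (λ i j i≢j (x , x∈) → let x∈i , x∈j = x∈p∩q⁻ _ _ x∈ in
    i≢j (trans (sym (∈-blocks⁻ w x∈i)) (∈-blocks⁻ w x∈j)))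
  (⊆-antisym ⊆⊤ λ {x} _ → ∈-⋃⁺ (blocks w) (lookup w x) (∈-blocks⁺ w refl))

partition⇒onto : {w : Vec (Fin k) n} → IsOrderedPartition (blocks w) → ∀ i → i ∈ᵥ w
partition⇒onto {w = w} P i =
  let x , x∈ = IsOrderedPartition.nonempty P i
  in subst (_∈ᵥ w) (∈-blocks⁻ w x∈) (∈-lookup x w)

-- The union condition supplies a block for every element, whose index becomes the letter;
-- disjointness makes this choice the only possible one, so no element of a block is lost.
partition⇒blocks : {B : Vec (Subset n) k} → IsOrderedPartition B → ∃ λ w → B ≡ blocks w
partition⇒blocks {n = n} {k} {B} (isOrderedPartition _ disjoint union) =
  w , lookup-ext λ i → ⊆-antisym (∈-blocks⁺ w ∘ ∈⇒letter) (letter⇒∈ ∘ ∈-blocks⁻ w)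
  where
  cover : ∀ x → ∃ λ i → x ∈ lookup B i
  cover x = ∈-⋃⁻ B (subst (x ∈_) (sym union) ∈⊤)

  w : Vec (Fin k) n
  w = tabulate (proj₁ ∘ cover)

  letter⇒∈ : ∀ {i x} → lookup w x ≡ i → x ∈ lookup B i
  letter⇒∈ {x = x} refl =
    subst (λ i → x ∈ lookup B i) (sym (lookup∘tabulate _ x)) (proj₂ (cover x))

  ∈⇒letter : ∀ {i x} → x ∈ lookup B i → lookup w x ≡ i
  ∈⇒letter {i} {x} x∈ with lookup w x ≟ i
  ... | yes eq = eq
  ... | no neq = contradiction (x , x∈p∩q⁺ (letter⇒∈ refl , x∈)) (disjoint _ i neq)

-- Increasing position vectors and subsequences.

positive⇒suc : (p : Vec (Fin (suc n)) m) → (∀ j → Fin.zero {n} < lookup p j) →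
               ∃ λ q → p ≡ map suc q
positive⇒suc []          pos = [] , refl
positive⇒suc (zero ∷ p)  pos = contradiction (pos zero) λ ()
positive⇒suc (suc x ∷ p) pos =
  let q , eq = positive⇒suc p (pos ∘ suc) in x ∷ q , cong (suc x ∷_) eq

map-suc-increasing⁻ : (p : Vec (Fin n) m) → Increasing (map suc p) → Increasing p
map-suc-increasing⁻ p inc a c a<c =
  ℕ.s<s⁻¹ (subst₂ _<_ (lookup-map a suc p) (lookup-map c suc p) (inc a c a<c))

map-suc-increasing⁺ : (p : Vec (Fin n) m) → Increasing p → Increasing (map suc p)
map-suc-increasing⁺ p inc a c a<c =
  subst₂ _<_ (sym (lookup-map a suc p)) (sym (lookup-map c suc p)) (s≤s (inc a c a<c))

tail-increasing : {x : Fin n} {p : Vec (Fin n) m} → Increasing (x ∷ p) → Increasing p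
tail-increasing inc a c a<c = inc (suc a) (suc c) (s≤s a<c)

map-lookup-suc : (l : A) (w : Vec A n) (p : Vec (Fin n) m) →
                 map (lookup (l ∷ w)) (map suc p) ≡ map (lookup w) p
map-lookup-suc l w p = sym (map-∘ _ _ p)

-- Induction on the word. If the first position is `zero`, the first letter is taken and the later
-- positions are all positive; otherwise every position is positive and the letter is skipped. In
-- both cases `positive⇒suc` shifts the remaining positions down to the shorter word.
increasing⇒≼ : (w : Vec A n) (p : Vec (Fin n) m) → Increasing p →
               toList (map (lookup w) p) ≼ toList w
increasing⇒≼ w       []          inc = minimum _
increasing⇒≼ (l ∷ w) (zero ∷ p)  inc
  with q , refl ← positive⇒suc p (λ j → inc zero (suc j) (s≤s z≤n)) =
  refl ∷ subst (λ v → toList v ≼ toList w) (sym (map-lookup-suc l w q))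
           (increasing⇒≼ w q (map-suc-increasing⁻ q (tail-increasing inc)))
increasing⇒≼ (l ∷ w) (suc x ∷ p) inc
  with q , refl ← positive⇒suc p (λ j → ℕ.≤-trans (s≤s z≤n) (inc zero (suc j) (s≤s z≤n))) =
  l ∷ʳ subst (λ v → toList v ≼ toList w) (sym (map-lookup-suc l w (x ∷ q)))
         (increasing⇒≼ w (x ∷ q) (map-suc-increasing⁻ (x ∷ q) inc))

≼⇒increasing : (w : Vec A n) (u : Vec A m) → toList u ≼ toList w →
               ∃ λ p → Increasing p × map (lookup w) p ≡ u
≼⇒increasing w       []      _        = [] , (λ ()) , refl
≼⇒increasing (l ∷ w) (y ∷ u) (.l ∷ʳ τ) =
  let p , inc , eq = ≼⇒increasing w (y ∷ u) τ
  in map suc p , map-suc-increasing⁺ p inc , trans (map-lookup-suc l w p) eq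
≼⇒increasing (l ∷ w) (.l ∷ u) (refl ∷ τ) =
  let p , inc , eq = ≼⇒increasing w u τ
  in zero ∷ map suc p , zero∷ p inc , cong (l ∷_) (trans (map-lookup-suc l w p) eq)
  where
  zero∷ : ∀ {m n} (p : Vec (Fin n) m) → Increasing p → Increasing (zero ∷ map suc p)
  zero∷ {n = n} p inc zero    (suc c) _         =
    subst (Fin.zero {n} <_) (sym (lookup-map c suc p)) (s≤s z≤n)
  zero∷ p inc (suc a) (suc c) (s≤s a<c) = map-suc-increasing⁺ p inc a c a<c

-- This is what forces the block indices of an occurrence when the pattern is as long as the number
-- of blocks.
increasing-endo : (p : Vec (Fin k) k) → Increasing p → p ≡ Vec.allFin k
increasing-endo {k} p inc = begin
  p                ≡⟨ cast-is-id refl p ⟨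
  Vec.cast refl p  ≡⟨ toList-injective refl p (Vec.allFin k) eq ⟩
  Vec.allFin k     ∎
  where
  open ≡-Reasoning
  eq : toList p ≡ toList (Vec.allFin k)
  -- In the word `allFin k` every letter equals its position, so `p` itself is the subsequence
  -- selected by `p`. A sublist as long as the whole list equals it.
  eq = Pointwise-≡⇒≡ (to-≋ (trans (length-toList p) (sym (length-toList (Vec.allFin k))))
         (subst (λ v → toList v ≼ _) (trans (map-cong lookup-allFin p) (map-id p))
                (increasing⇒≼ (Vec.allFin k) p inc)))

-- `OrderIsomorphic` asks for an equivalence; this supplies the converse of monotonicity, by
-- trichotomy.
increasing-reflects : (p : Vec (Fin n) m) → Increasing p →
                      ∀ a c → lookup p a < lookup p c → a < c
increasing-reflects p inc a c lt with <-cmp a c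
... | tri< a<c _    _   = a<c
... | tri≈ _   refl _   = contradiction lt (<-irrefl refl)
... | tri> _   _    c<a = contradiction (inc c a c<a) (<-asym lt)

-- Order isomorphism with the identity says that the elements `b` increase, so they serve as
-- positions in `w`. The letters found there are the block indices, which can only be all of `Fin k`
-- in order.
contains⇒≼ : (w : Vec (Fin k) n) →
             Contains (blocks w) (id {k}) → toList (Vec.allFin k) ≼ toList w
contains⇒≼ {k} w (is , b , is-inc , b∈ , iso) =
  subst (λ v → toList v ≼ toList w) letters
    (increasing⇒≼ w b λ a c → Equivalence.from (iso a c))
  where
  letters : map (lookup w) b ≡ Vec.allFin k
  letters = trans (lookup-ext λ j → trans (lookup-map j _ b) (∈-blocks⁻ w (b∈ j)))
                  (increasing-endo is is-inc)

≼⇒contains : (w : Vec (Fin k) n) →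
             toList (Vec.allFin k) ≼ toList w → Contains (blocks w) (id {k})
≼⇒contains {k} w τ =
  let b , b-inc , eq = ≼⇒increasing w (Vec.allFin k) τ
  in Vec.allFin k , b
     , (λ a c → subst₂ _<_ (sym (lookup-allFin a)) (sym (lookup-allFin c)))
     , (λ j → ∈-blocks⁺ w (trans (sym (lookup-map j _ b)) (cong (flip lookup j) eq)))
     , (λ a c → mk⇔ (increasing-reflects b b-inc a c) (b-inc a c))

-- Reduction of `op` to counting words.

Admissible : List (Fin k) → List (Fin k) → Vec (Fin k) n → Set
Admissible need pat w = All (_∈ᵥ w) need × ¬ (pat ≼ toList w)

admissible? : (need pat : List (Fin k)) → Decidable (Admissible {n = n} need pat)
admissible? need pat w =
  All.all? (λ i → DecMembership._∈?_ _≟_ i w) need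
  ×-dec ¬? (DecSublist._⊆?_ _≟_ pat (toList w))

words : ∀ k n → List (Vec (Fin k) n)
words k = vectors (List.allFin k)

count : List (Fin k) → List (Fin k) → ℕ → ℕ
count {k} need pat n = length (filter (admissible? need pat) (words k n))

-- `blocks` is a bijection from admissible words to avoiding partitions. Both lists are free of
-- duplicates, so having the same members makes them permutations of each other and hence equally
-- long.
op≡count : ∀ n k → op n k (id {k}) ≡ count (List.allFin k) (toList (Vec.allFin k)) n
op≡count n k = begin
  op n k (id {k})
    ≡⟨ ↭-length (∼bag⇒↭ (unique∧set⇒bag unique-avoiders unique-words (mk⇔ to from))) ⟩
  length (List.map blocks good)
    ≡⟨ length-map blocks good ⟩
  length good ∎
  where
  open ≡-Reasoning

  need pat : List (Fin k)
  need = List.allFin k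
  pat  = toList (Vec.allFin k)

  good : List (Vec (Fin k) n)
  good = filter (admissible? need pat) (words k n)

  avoider? : Decidable (λ (B : Vec (Subset n) k) → IsOrderedPartition B × Avoids B (id {k}))
  avoider? B = isOrderedPartition? B ×-dec avoids? B id

  unique-avoiders : Unique (filter avoider? (vectors (subsets n) k))
  unique-avoiders = Unique.filter⁺ avoider? (candidates-unique n k)

  unique-words : Unique (List.map blocks good)
  unique-words = Unique.map⁺ blocks-injective
    (Unique.filter⁺ (admissible? need pat) (vectors-unique (allFin⁺ k) n))

  to : ∀ {B} → B List.∈ filter avoider? (vectors (subsets n) k) → B List.∈ List.map blocks good
  to B∈ with _ , P , avoids ← ∈-filter⁻ avoider? {xs = vectors (subsets n) k} B∈
        with w , refl ← partition⇒blocks P =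
    ∈-map⁺ blocks (∈-filter⁺ (admissible? need pat) (vectors-complete ∈-allFin w)
      (All.tabulate (λ {i} _ → partition⇒onto P i) , avoids ∘ ≼⇒contains w))

  from : ∀ {B} → B List.∈ List.map blocks good → B List.∈ filter avoider? (vectors (subsets n) k)
  from B∈ with w , w∈ , refl ← ∈-map⁻ blocks B∈
          with _ , onto , avoids ← ∈-filter⁻ (admissible? need pat) {xs = words k n} w∈ =
    ∈-filter⁺ avoider? (candidates-complete (blocks w))
      (onto⇒partition (λ i → All.lookup onto (∈-allFin i)) , avoids ∘ contains⇒≼ w)

-- Reading off the first letter.

discard : Fin k → List (Fin k) → List (Fin k)
discard l = filter (λ i → ¬? (i ≟ l))

advance : Fin k → List (Fin k) → List (Fin k)
advance l []        = []
advance l (i ∷ pat) = if does (i ≟ l) then pat else i ∷ pat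

all-discard⁺ : ∀ (l : Fin k) (w : Vec (Fin k) n) need →
               All (_∈ᵥ (l ∷ w)) need → All (_∈ᵥ w) (discard l need)
all-discard⁺ l w []         []        = []
all-discard⁺ l w (i ∷ need) (i∈ ∷ is) with i ≟ l | i∈
... | yes _  | _          = all-discard⁺ l w need is
... | no i≢l | here i≡l   = contradiction i≡l i≢l
... | no _   | there i∈w  = i∈w ∷ all-discard⁺ l w need is

all-discard⁻ : ∀ (l : Fin k) (w : Vec (Fin k) n) need →
               All (_∈ᵥ w) (discard l need) → All (_∈ᵥ (l ∷ w)) need
all-discard⁻ l w []         _  = []
all-discard⁻ l w (i ∷ need) is with i ≟ l | is
... | yes i≡l | is′       = here i≡l ∷ all-discard⁻ l w need is′
... | no _    | i∈w ∷ is′ = there i∈w ∷ all-discard⁻ l w need is′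

-- Greedy matching loses nothing: if the pattern begins with `l`, any embedding still embeds its
-- tail after `l`; if not, `l` cannot be the image of its first letter and the whole pattern embeds
-- later.
≼-advance⁺ : ∀ (l : Fin k) pat {ls} → pat ≼ (l ∷ ls) → advance l pat ≼ ls
≼-advance⁺ l []        τ = minimum _
≼-advance⁺ l (i ∷ pat) τ with i ≟ l
... | yes _  = ∷⁻ τ
... | no i≢l = ∷ʳ⁻ i≢l τ

≼-advance⁻ : ∀ (l : Fin k) pat {ls} → advance l pat ≼ ls → pat ≼ (l ∷ ls)
≼-advance⁻ l []        τ = minimum _
≼-advance⁻ l (i ∷ pat) τ with i ≟ l
... | yes i≡l = i≡l ∷ τ
... | no _    = l ∷ʳ τ

length-filter-map : {P : Pred B 0ℓ} (P? : Decidable P) (f : A → B) (xs : List A) →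
                    length (filter P? (List.map f xs)) ≡ length (filter (P? ∘ f) xs)
length-filter-map P? f []       = refl
length-filter-map P? f (x ∷ xs) with does (P? (f x))
... | true  = cong suc (length-filter-map P? f xs)
... | false = length-filter-map P? f xs

length-filter-cartesianProductWith :
  {C : Set} {P : Pred C 0ℓ} (P? : Decidable P) (f : A → B → C) (xs : List A) (ys : List B) →
  length (filter P? (cartesianProductWith f xs ys))
    ≡ sum (List.map (λ x → length (filter (P? ∘ f x) ys)) xs)
length-filter-cartesianProductWith P? f []       ys = refl
length-filter-cartesianProductWith P? f (x ∷ xs) ys = begin
  length (filter P? (List.map (f x) ys List.++ rest))
    ≡⟨ cong length (filter-++ P? (List.map (f x) ys) rest) ⟩
  length (filter P? (List.map (f x) ys) List.++ filter P? rest)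
    ≡⟨ length-++ (filter P? (List.map (f x) ys)) ⟩
  length (filter P? (List.map (f x) ys)) ℕ.+ length (filter P? rest)
    ≡⟨ cong₂ ℕ._+_ (length-filter-map P? (f x) ys) (length-filter-cartesianProductWith P? f xs ys) ⟩
  sum (List.map (λ x → length (filter (P? ∘ f x) ys)) (x ∷ xs)) ∎
  where
  open ≡-Reasoning
  rest = cartesianProductWith f xs ys

-- Splits the words by first letter. The condition left on the remainder is again an `Admissible`
-- one, so the counts with all possible `need` and `pat` form a closed system of recurrences.
count-suc : (need pat : List (Fin k)) (n : ℕ) →
            count need pat (suc n)
              ≡ sum (List.map (λ l → count (discard l need) (advance l pat) n) (List.allFin k))
count-suc {k} need pat n = trans
  (length-filter-cartesianProductWith (admissible? need pat) _∷_ (List.allFin k) (words k n))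
  (cong sum (map-congˡ residual (List.allFin k)))
  where
  residual : ∀ l → length (filter (admissible? need pat ∘ (l ∷_)) (words k n))
                     ≡ count (discard l need) (advance l pat) n
  residual l = cong length (filter-≐ _ (admissible? (discard l need) (advance l pat))
    -- Avoidance is a negation, so each direction pairs a `discard` lemma with the opposite
    -- `advance` lemma.
    ( (λ {w} (onto , avoids) → all-discard⁺ l w need onto , avoids ∘ ≼-advance⁻ l pat)
    , (λ {w} (onto , avoids) → all-discard⁻ l w need onto , avoids ∘ ≼-advance⁺ l pat))
    (words k n))

-- The recurrences for three letters and their solutions.

count-suc₃ : (need pat : List (Fin 3)) (n : ℕ) →
             count need pat (suc n)
               ≡ count (discard 0F need) (advance 0F pat) n
                 ℕ.+ count (discard 1F need) (advance 1F pat) n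
                 ℕ.+ count (discard 2F need) (advance 2F pat) n
count-suc₃ need pat n = trans (count-suc need pat n)
  (reassociate (count (discard 0F need) (advance 0F pat) n) _ _)
  where
  reassociate : ∀ a b c → a ℕ.+ (b ℕ.+ (c ℕ.+ 0)) ≡ a ℕ.+ b ℕ.+ c
  reassociate = solve-∀

-- A completed pattern embeds in every word, so these branches of the recurrences vanish.
count-[]-pattern : ∀ (need : List (Fin k)) n → count need [] n ≡ 0
count-[]-pattern {k} need n = cong length
  (filter-none (admissible? need [])
    (All.universal (λ _ (_ , avoids) → avoids (minimum _)) (words k n)))

-- In count-u-v the needed letters are those of u and the pattern is v.
-- Truncated subtraction is avoided by moving negative terms to the other side.
count-2-2 : ∀ n → count {3} (2F ∷ []) (2F ∷ []) n ≡ 0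
count-2-2 zero    = refl
count-2-2 (suc n) = trans (count-suc₃ (2F ∷ []) (2F ∷ []) n)
  (cong₂ ℕ._+_ (cong₂ ℕ._+_ (count-2-2 n) (count-2-2 n)) (count-[]-pattern [] n))

-- Reading `2F` completes the pattern, while each of the other two letters changes nothing, so the
-- count doubles.
count-∅-2 : ∀ n → count {3} [] (2F ∷ []) n ≡ 2 ℕ.^ n
count-∅-2 zero    = refl
count-∅-2 (suc n) = trans (count-suc₃ [] (2F ∷ []) n) (trans
  (cong₂ ℕ._+_ (cong₂ ℕ._+_ (count-∅-2 n) (count-∅-2 n)) (count-[]-pattern [] n))
  (double (2 ℕ.^ n)))
  where
  double : ∀ t → t ℕ.+ t ℕ.+ 0 ≡ 2 ℕ.* t
  double = solve-∀

-- With d for this count, d(n+1) = 2 d(n) + 2ⁿ and d(0) = 1: only `1F` advances the pattern. The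
-- factor 2 clears the denominator of (n+2) 2ⁿ / 2.
count-∅-12 : ∀ n → 2 ℕ.* count {3} [] (1F ∷ 2F ∷ []) n ≡ (2 ℕ.+ n) ℕ.* 2 ℕ.^ n
count-∅-12 zero    = refl
count-∅-12 (suc n) = trans (cong (2 ℕ.*_) (count-suc₃ [] (1F ∷ 2F ∷ []) n))
  (step (count [] (1F ∷ 2F ∷ []) n) n (count-∅-12 n) (count-∅-2 n))
  where
  expand : ∀ d t → 2 ℕ.* (d ℕ.+ t ℕ.+ d) ≡ 2 ℕ.* (2 ℕ.* d) ℕ.+ 2 ℕ.* t
  expand = solve-∀
  collect : ∀ n t → 2 ℕ.* ((2 ℕ.+ n) ℕ.* t) ℕ.+ 2 ℕ.* t ≡ (3 ℕ.+ n) ℕ.* (2 ℕ.* t)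
  collect = solve-∀
  step : ∀ d n {t u} → 2 ℕ.* d ≡ (2 ℕ.+ n) ℕ.* t → u ≡ t →
         2 ℕ.* (d ℕ.+ u ℕ.+ d) ≡ (3 ℕ.+ n) ℕ.* (2 ℕ.* t)
  step d n {t} eq refl = trans (expand d t)
    (trans (cong (λ x → 2 ℕ.* x ℕ.+ 2 ℕ.* t) eq) (collect n t))

-- Reading `1F` leaves `2F` both needed and forbidden, hence nothing; `2F` lifts the requirement and
-- leads to `count-∅-12`.
count-2-12 : ∀ n → 2 ℕ.* count {3} (2F ∷ []) (1F ∷ 2F ∷ []) n ≡ n ℕ.* 2 ℕ.^ n
count-2-12 zero    = refl
count-2-12 (suc n) = trans (cong (2 ℕ.*_) (count-suc₃ (2F ∷ []) (1F ∷ 2F ∷ []) n))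
  (step (count (2F ∷ []) (1F ∷ 2F ∷ []) n)
        (count [] (1F ∷ 2F ∷ []) n)
        n (2 ℕ.^ n) (count-2-12 n) (count-2-2 n) (count-∅-12 n))
  where
  expand : ∀ e d → 2 ℕ.* (e ℕ.+ 0 ℕ.+ d) ≡ 2 ℕ.* e ℕ.+ 2 ℕ.* d
  expand = solve-∀
  collect : ∀ n t → n ℕ.* t ℕ.+ (2 ℕ.+ n) ℕ.* t ≡ (1 ℕ.+ n) ℕ.* (2 ℕ.* t)
  collect = solve-∀
  step : ∀ e d n t {z} → 2 ℕ.* e ≡ n ℕ.* t → z ≡ 0 → 2 ℕ.* d ≡ (2 ℕ.+ n) ℕ.* t →
         2 ℕ.* (e ℕ.+ z ℕ.+ d) ≡ (1 ℕ.+ n) ℕ.* (2 ℕ.* t)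
  step e d n t eqᵉ refl eqᵈ =
    trans (expand e d) (trans (cong₂ ℕ._+_ eqᵉ eqᵈ) (collect n t))

-- The recurrence is that of `count-∅-12`, but started at 0, since the empty word lacks `1F`.
count-1-12 : ∀ n → 2 ℕ.* count {3} (1F ∷ []) (1F ∷ 2F ∷ []) n ≡ n ℕ.* 2 ℕ.^ n
count-1-12 zero    = refl
count-1-12 (suc n) = trans (cong (2 ℕ.*_) (count-suc₃ (1F ∷ []) (1F ∷ 2F ∷ []) n))
  (step (count (1F ∷ []) (1F ∷ 2F ∷ []) n) n (count-1-12 n) (count-∅-2 n))
  where
  expand : ∀ g t → 2 ℕ.* (g ℕ.+ t ℕ.+ g) ≡ 2 ℕ.* (2 ℕ.* g) ℕ.+ 2 ℕ.* t
  expand = solve-∀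
  collect : ∀ n t → 2 ℕ.* (n ℕ.* t) ℕ.+ 2 ℕ.* t ≡ (1 ℕ.+ n) ℕ.* (2 ℕ.* t)
  collect = solve-∀
  step : ∀ g n {t u} → 2 ℕ.* g ≡ n ℕ.* t → u ≡ t →
         2 ℕ.* (g ℕ.+ u ℕ.+ g) ≡ (1 ℕ.+ n) ℕ.* (2 ℕ.* t)
  step g n {t} eq refl = trans (expand g t)
    (trans (cong (λ x → 2 ℕ.* x ℕ.+ 2 ℕ.* t) eq) (collect n t))

-- Reading `1F` first is fatal and `2F` leads to `count-1-12`, so the count is the sum of j 2ʲ / 2
-- over j < n, which is (n-2) 2ⁿ / 2 + 1.
count-12-12 : ∀ n → 2 ℕ.* count {3} (1F ∷ 2F ∷ []) (1F ∷ 2F ∷ []) n ℕ.+ 2 ℕ.* 2 ℕ.^ n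
                      ≡ n ℕ.* 2 ℕ.^ n ℕ.+ 2
count-12-12 zero    = refl
count-12-12 (suc n) = trans
  (cong (λ c → 2 ℕ.* c ℕ.+ 2 ℕ.* 2 ℕ.^ suc n) (count-suc₃ (1F ∷ 2F ∷ []) (1F ∷ 2F ∷ []) n))
  (step (count (1F ∷ 2F ∷ []) (1F ∷ 2F ∷ []) n)
        (count (1F ∷ []) (1F ∷ 2F ∷ []) n)
        n (2 ℕ.^ n) (count-12-12 n) (count-2-2 n) (count-1-12 n))
  where
  expand : ∀ h g t → 2 ℕ.* (h ℕ.+ 0 ℕ.+ g) ℕ.+ 2 ℕ.* (2 ℕ.* t)
                       ≡ (2 ℕ.* h ℕ.+ 2 ℕ.* t) ℕ.+ 2 ℕ.* g ℕ.+ 2 ℕ.* t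
  expand = solve-∀
  collect : ∀ n t → (n ℕ.* t ℕ.+ 2) ℕ.+ n ℕ.* t ℕ.+ 2 ℕ.* t ≡ (1 ℕ.+ n) ℕ.* (2 ℕ.* t) ℕ.+ 2
  collect = solve-∀
  step : ∀ h g n t {z} → 2 ℕ.* h ℕ.+ 2 ℕ.* t ≡ n ℕ.* t ℕ.+ 2 → z ≡ 0 → 2 ℕ.* g ≡ n ℕ.* t →
         2 ℕ.* (h ℕ.+ z ℕ.+ g) ℕ.+ 2 ℕ.* (2 ℕ.* t) ≡ (1 ℕ.+ n) ℕ.* (2 ℕ.* t) ℕ.+ 2
  step h g n t eqʰ refl eqᵍ =
    trans (expand h g t) (trans (cong (ℕ._+ 2 ℕ.* t) (cong₂ ℕ._+_ eqʰ eqᵍ)) (collect n t))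

-- The first `0F` both meets the requirement and advances the pattern; the other letters do neither.
-- The linear forcing term of `count-∅-12` makes the solution quadratic times 2ⁿ.
count-0-012 : ∀ n → 8 ℕ.* count {3} (0F ∷ []) (0F ∷ 1F ∷ 2F ∷ []) n
                      ≡ n ℕ.* (3 ℕ.+ n) ℕ.* 2 ℕ.^ n
count-0-012 zero    = refl
count-0-012 (suc n) = trans (cong (8 ℕ.*_) (count-suc₃ (0F ∷ []) (0F ∷ 1F ∷ 2F ∷ []) n))
  (step (count [] (1F ∷ 2F ∷ []) n)
        (count (0F ∷ []) (0F ∷ 1F ∷ 2F ∷ []) n)
        n (2 ℕ.^ n) (count-∅-12 n) (count-0-012 n))
  where
  expand : ∀ d κ → 8 ℕ.* (d ℕ.+ κ ℕ.+ κ) ≡ 4 ℕ.* (2 ℕ.* d) ℕ.+ 2 ℕ.* (8 ℕ.* κ)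
  expand = solve-∀
  collect : ∀ n t → 4 ℕ.* ((2 ℕ.+ n) ℕ.* t) ℕ.+ 2 ℕ.* (n ℕ.* (3 ℕ.+ n) ℕ.* t)
                      ≡ (1 ℕ.+ n) ℕ.* (4 ℕ.+ n) ℕ.* (2 ℕ.* t)
  collect = solve-∀
  step : ∀ d κ n t → 2 ℕ.* d ≡ (2 ℕ.+ n) ℕ.* t → 8 ℕ.* κ ≡ n ℕ.* (3 ℕ.+ n) ℕ.* t →
         8 ℕ.* (d ℕ.+ κ ℕ.+ κ) ≡ (1 ℕ.+ n) ℕ.* (4 ℕ.+ n) ℕ.* (2 ℕ.* t)
  step d κ n t eqᵈ eqᵏ = trans (expand d κ)
    (trans (cong₂ (λ x y → 4 ℕ.* x ℕ.+ 2 ℕ.* y) eqᵈ eqᵏ) (collect n t))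

private
  -- Shared by the two cases below: `count-1-12` and `count-2-12` have the same closed form, so the
  -- recurrences agree after exchanging two summands.
  two-letters-step : ∀ e κ l n t → 2 ℕ.* e ≡ n ℕ.* t → 8 ℕ.* κ ≡ n ℕ.* (3 ℕ.+ n) ℕ.* t →
    8 ℕ.* l ℕ.+ 8 ℕ.* t ≡ n ℕ.* (3 ℕ.+ n) ℕ.* t ℕ.+ 8 →
    8 ℕ.* (e ℕ.+ κ ℕ.+ l) ℕ.+ 8 ℕ.* (2 ℕ.* t)
      ≡ (1 ℕ.+ n) ℕ.* (4 ℕ.+ n) ℕ.* (2 ℕ.* t) ℕ.+ 8
  two-letters-step e κ l n t eqᵉ eqᵏ eqˡ = trans (expand e κ l t) (trans
    (cong₂ (λ x y → x ℕ.+ y ℕ.+ 8 ℕ.* t) (cong₂ (λ x y → 4 ℕ.* x ℕ.+ y) eqᵉ eqᵏ) eqˡ)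
    (collect n t))
    where
    expand : ∀ e κ l t → 8 ℕ.* (e ℕ.+ κ ℕ.+ l) ℕ.+ 8 ℕ.* (2 ℕ.* t)
               ≡ (4 ℕ.* (2 ℕ.* e) ℕ.+ 8 ℕ.* κ) ℕ.+ (8 ℕ.* l ℕ.+ 8 ℕ.* t) ℕ.+ 8 ℕ.* t
    expand = solve-∀
    collect : ∀ n t → (4 ℕ.* (n ℕ.* t) ℕ.+ n ℕ.* (3 ℕ.+ n) ℕ.* t)
                        ℕ.+ (n ℕ.* (3 ℕ.+ n) ℕ.* t ℕ.+ 8) ℕ.+ 8 ℕ.* t
                      ≡ (1 ℕ.+ n) ℕ.* (4 ℕ.+ n) ℕ.* (2 ℕ.* t) ℕ.+ 8
    collect = solve-∀

count-01-012 : ∀ n → 8 ℕ.* count {3} (0F ∷ 1F ∷ []) (0F ∷ 1F ∷ 2F ∷ []) n ℕ.+ 8 ℕ.* 2 ℕ.^ n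
                       ≡ n ℕ.* (3 ℕ.+ n) ℕ.* 2 ℕ.^ n ℕ.+ 8
count-01-012 zero    = refl
count-01-012 (suc n) = trans
  (cong (λ c → 8 ℕ.* c ℕ.+ 8 ℕ.* 2 ℕ.^ suc n)
        (count-suc₃ (0F ∷ 1F ∷ []) (0F ∷ 1F ∷ 2F ∷ []) n))
  (two-letters-step
    (count (1F ∷ []) (1F ∷ 2F ∷ []) n)
    (count (0F ∷ []) (0F ∷ 1F ∷ 2F ∷ []) n)
    (count (0F ∷ 1F ∷ []) (0F ∷ 1F ∷ 2F ∷ []) n)
    n (2 ℕ.^ n) (count-1-12 n) (count-0-012 n) (count-01-012 n))

count-02-012 : ∀ n → 8 ℕ.* count {3} (0F ∷ 2F ∷ []) (0F ∷ 1F ∷ 2F ∷ []) n ℕ.+ 8 ℕ.* 2 ℕ.^ n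
                       ≡ n ℕ.* (3 ℕ.+ n) ℕ.* 2 ℕ.^ n ℕ.+ 8
count-02-012 zero    = refl
count-02-012 (suc n) = trans
  (cong (λ c → 8 ℕ.* c ℕ.+ 8 ℕ.* 2 ℕ.^ suc n)
        (trans (count-suc₃ (0F ∷ 2F ∷ []) (0F ∷ 1F ∷ 2F ∷ []) n)
               (swap (count (2F ∷ []) (1F ∷ 2F ∷ []) n)
                     (count (0F ∷ 2F ∷ []) (0F ∷ 1F ∷ 2F ∷ []) n)
                     (count (0F ∷ []) (0F ∷ 1F ∷ 2F ∷ []) n))))
  (two-letters-step
    (count (2F ∷ []) (1F ∷ 2F ∷ []) n)
    (count (0F ∷ []) (0F ∷ 1F ∷ 2F ∷ []) n)
    (count (0F ∷ 2F ∷ []) (0F ∷ 1F ∷ 2F ∷ []) n)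
    n (2 ℕ.^ n) (count-2-12 n) (count-0-012 n) (count-02-012 n))
  where
  swap : ∀ a b c → a ℕ.+ b ℕ.+ c ≡ a ℕ.+ c ℕ.+ b
  swap = solve-∀

-- Every letter is still needed, so each one leads to a smaller set of needed letters and no
-- induction occurs. The closed form fails for the empty word, hence `suc n`.
count-012-012 : ∀ n → 8 ℕ.* count {3} (0F ∷ 1F ∷ 2F ∷ []) (0F ∷ 1F ∷ 2F ∷ []) (suc n)
                        ℕ.+ 16 ℕ.* 2 ℕ.^ suc n
                        ≡ suc n ℕ.* (4 ℕ.+ n) ℕ.* 2 ℕ.^ suc n ℕ.+ 24
count-012-012 n = trans
  (cong (λ c → 8 ℕ.* c ℕ.+ 16 ℕ.* 2 ℕ.^ suc n)
        (count-suc₃ (0F ∷ 1F ∷ 2F ∷ []) (0F ∷ 1F ∷ 2F ∷ []) n))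
  (step (count (1F ∷ 2F ∷ []) (1F ∷ 2F ∷ []) n)
        (count (0F ∷ 2F ∷ []) (0F ∷ 1F ∷ 2F ∷ []) n)
        (count (0F ∷ 1F ∷ []) (0F ∷ 1F ∷ 2F ∷ []) n)
        n (2 ℕ.^ n) (count-12-12 n) (count-02-012 n) (count-01-012 n))
  where
  expand : ∀ h l m t → 8 ℕ.* (h ℕ.+ l ℕ.+ m) ℕ.+ 16 ℕ.* (2 ℕ.* t)
             ≡ 4 ℕ.* (2 ℕ.* h ℕ.+ 2 ℕ.* t) ℕ.+ (8 ℕ.* l ℕ.+ 8 ℕ.* t)
               ℕ.+ (8 ℕ.* m ℕ.+ 8 ℕ.* t) ℕ.+ 8 ℕ.* t
  expand = solve-∀
  collect : ∀ n t → 4 ℕ.* (n ℕ.* t ℕ.+ 2) ℕ.+ (n ℕ.* (3 ℕ.+ n) ℕ.* t ℕ.+ 8)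
                      ℕ.+ (n ℕ.* (3 ℕ.+ n) ℕ.* t ℕ.+ 8) ℕ.+ 8 ℕ.* t
                    ≡ (1 ℕ.+ n) ℕ.* (4 ℕ.+ n) ℕ.* (2 ℕ.* t) ℕ.+ 24
  collect = solve-∀
  step : ∀ h l m n t → 2 ℕ.* h ℕ.+ 2 ℕ.* t ≡ n ℕ.* t ℕ.+ 2 →
         8 ℕ.* l ℕ.+ 8 ℕ.* t ≡ n ℕ.* (3 ℕ.+ n) ℕ.* t ℕ.+ 8 →
         8 ℕ.* m ℕ.+ 8 ℕ.* t ≡ n ℕ.* (3 ℕ.+ n) ℕ.* t ℕ.+ 8 →
         8 ℕ.* (h ℕ.+ l ℕ.+ m) ℕ.+ 16 ℕ.* (2 ℕ.* t)
           ≡ (1 ℕ.+ n) ℕ.* (4 ℕ.+ n) ℕ.* (2 ℕ.* t) ℕ.+ 24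
  step h l m n t eqʰ eqˡ eqᵐ = trans (expand h l m t) (trans
    (cong₂ (λ x y → x ℕ.+ y ℕ.+ 8 ℕ.* t) (cong₂ (λ x y → 4 ℕ.* x ℕ.+ y) eqʰ eqˡ) eqᵐ)
    (collect n t))

-- Passage to the rational formula.

toℚᵘ-/ : ∀ i d → toℚᵘ (i / suc d) ≃ mkℚᵘ i d
toℚᵘ-/ i d = ℚ.toℚᵘ-fromℚᵘ (mkℚᵘ i d)

-- Unnormalised fractions are not reduced to lowest terms, so there the claim becomes a polynomial
-- identity over the integers.
clear-denominators : ∀ c a b t → 8 ℕ.* c ℕ.+ 16 ℕ.* t ≡ (a ℕ.+ b) ℕ.* t ℕ.+ 24 →
  (+ c) / 1 ≡ ((+ a) / 8 + (+ b) / 8 - (+ 2) / 1) * ((+ t) / 1) + (+ 3) / 1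
clear-denominators c a b t eq = ℚ.toℚᵘ-injective (begin
  toℚᵘ ((+ c) / 1)               ≈⟨ toℚᵘ-/ (+ c) 0 ⟩
  mkℚᵘ (+ c) 0                   ≈⟨ *≡* cross-multiplied ⟩
  rᵘ ℚᵘ.* mkℚᵘ (+ t) 0 ℚᵘ.+ 3ᵘ    ≈⟨ ℚᵘ.+-congˡ 3ᵘ (ℚᵘ.*-cong r≃rᵘ (toℚᵘ-/ (+ t) 0)) ⟨
  toℚᵘ r ℚᵘ.* toℚᵘ tᵣ ℚᵘ.+ 3ᵘ     ≈⟨ ℚᵘ.+-congˡ 3ᵘ (ℚ.toℚᵘ-homo-* r tᵣ) ⟨
  toℚᵘ (r * tᵣ) ℚᵘ.+ 3ᵘ          ≈⟨ ℚ.toℚᵘ-homo-+ (r * tᵣ) ((+ 3) / 1) ⟨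
  toℚᵘ (r * tᵣ + (+ 3) / 1)      ∎)
  where
  open import Relation.Binary.Reasoning.Setoid ℚᵘ.≃-setoid

  s  = (+ a) / 8 + (+ b) / 8
  r  = s - (+ 2) / 1
  tᵣ = (+ t) / 1
  2ᵘ = mkℚᵘ (+ 2) 0
  3ᵘ = mkℚᵘ (+ 3) 0
  sᵘ = mkℚᵘ (+ a) 7 ℚᵘ.+ mkℚᵘ (+ b) 7
  rᵘ = sᵘ ℚᵘ.+ (ℚᵘ.- 2ᵘ)

  r≃rᵘ : toℚᵘ r ≃ rᵘ
  r≃rᵘ = begin
    toℚᵘ r                     ≈⟨ ℚ.toℚᵘ-homo-+ s (- ((+ 2) / 1)) ⟩
    toℚᵘ s ℚᵘ.+ (ℚᵘ.- 2ᵘ)      ≈⟨ ℚᵘ.+-congˡ (ℚᵘ.- 2ᵘ) (ℚ.toℚᵘ-homo-+ ((+ a) / 8) ((+ b) / 8)) ⟩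
    toℚᵘ ((+ a) / 8) ℚᵘ.+ toℚᵘ ((+ b) / 8) ℚᵘ.+ (ℚᵘ.- 2ᵘ)
      ≈⟨ ℚᵘ.+-congˡ (ℚᵘ.- 2ᵘ) (ℚᵘ.+-cong (toℚᵘ-/ (+ a) 7) (toℚᵘ-/ (+ b) 7)) ⟩
    rᵘ                         ∎

  integral : + 8 ℤ.* + c ℤ.+ + 16 ℤ.* + t ≡ (+ a ℤ.+ + b) ℤ.* + t ℤ.+ + 24
  integral = trans (sym (cong₂ ℤ._+_ (ℤ.pos-* 8 c) (ℤ.pos-* 16 t)))
    (trans (cong +_ eq) (cong (ℤ._+ + 24) (ℤ.pos-* (a ℕ.+ b) t)))

  -- The two eighths are added over the denominator 8 · 8 = 64, so the cross-multiplied equation is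
  -- 8 times `integral`, less 128 `t` on both sides.
  expand : ∀ c t → c ℤ.* + 64 ≡ + 8 ℤ.* (+ 8 ℤ.* c ℤ.+ + 16 ℤ.* t) ℤ.- + 128 ℤ.* t
  expand = ℤ-Solver.solve-∀
  collect : ∀ a b t → + 8 ℤ.* ((a ℤ.+ b) ℤ.* t ℤ.+ + 24) ℤ.- + 128 ℤ.* t
    ≡ (((a ℤ.* + 8 ℤ.+ b ℤ.* + 8) ℤ.* + 1 ℤ.+ ℤ.- (+ 2) ℤ.* + 64) ℤ.* t ℤ.* + 1
       ℤ.+ + 3 ℤ.* + 64) ℤ.* + 1
  collect = ℤ-Solver.solve-∀

  cross-multiplied : + c ℤ.* + 64
    ≡ (((+ a ℤ.* + 8 ℤ.+ + b ℤ.* + 8) ℤ.* + 1 ℤ.+ ℤ.- (+ 2) ℤ.* + 64) ℤ.* + t ℤ.* + 1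
       ℤ.+ + 3 ℤ.* + 64) ℤ.* + 1
  cross-multiplied = trans (expand (+ c) (+ t))
    (trans (cong (λ x → + 8 ℤ.* x ℤ.- + 128 ℤ.* + t) integral) (collect (+ a) (+ b) (+ t)))

op-123≡count : ∀ n → op n 3 pattern123 ≡ count (0F ∷ 1F ∷ 2F ∷ []) (0F ∷ 1F ∷ 2F ∷ []) n
op-123≡count n = trans (cong (op n 3) pattern123≡id) (op≡count n 3)
  where
  -- A separate step because comparing op n 3 pattern123 with op n 3 id directly
  -- makes the type checker unfold op.
  pattern123≡id : pattern123 ≡ id
  pattern123≡id = refl

op-123 : ∀ n → 8 ℕ.* op (suc n) 3 pattern123 ℕ.+ 16 ℕ.* 2 ℕ.^ suc n
                 ≡ (suc n ℕ.^ 2 ℕ.+ 3 ℕ.* suc n) ℕ.* 2 ℕ.^ suc n ℕ.+ 24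
op-123 n = begin
  8 ℕ.* op (suc n) 3 pattern123 ℕ.+ 16 ℕ.* 2 ℕ.^ suc n
    ≡⟨ cong (λ c → 8 ℕ.* c ℕ.+ 16 ℕ.* 2 ℕ.^ suc n) (op-123≡count (suc n)) ⟩
  8 ℕ.* count (0F ∷ 1F ∷ 2F ∷ []) (0F ∷ 1F ∷ 2F ∷ []) (suc n) ℕ.+ 16 ℕ.* 2 ℕ.^ suc n
    ≡⟨ count-012-012 n ⟩
  suc n ℕ.* (4 ℕ.+ n) ℕ.* 2 ℕ.^ suc n ℕ.+ 24
    ≡⟨ cong (λ q → q ℕ.* 2 ℕ.^ suc n ℕ.+ 24) (quadratic n) ⟩
  (suc n ℕ.^ 2 ℕ.+ 3 ℕ.* suc n) ℕ.* 2 ℕ.^ suc n ℕ.+ 24 ∎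
  where
  open ≡-Reasoning
  -- The right side spells out the square as `suc n ℕ.^ 2` unfolds.
  quadratic : ∀ n → (1 ℕ.+ n) ℕ.* (4 ℕ.+ n)
                      ≡ (1 ℕ.+ n) ℕ.* ((1 ℕ.+ n) ℕ.* 1) ℕ.+ 3 ℕ.* (1 ℕ.+ n)
  quadratic = solve-∀

theorem2 : (n : ℕ) → 1 ℕ.≤ n →
    (+ op n 3 pattern123) / 1
    ≡ ((+ (n ℕ.^ 2)) / 8 + (+ (3 ℕ.* n)) / 8 - (+ 2) / 1) * ((+ (2 ℕ.^ n)) / 1) + (+ 3) / 1
theorem2 n@(suc p) _ =
  clear-denominators (op n 3 pattern123) (n ℕ.^ 2) (3 ℕ.* n) (2 ℕ.^ n) (op-123 p)
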